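{- Let $k\ge2$ be an integer and let $n\ge4k-2$ be an even integer. Let $P$ be the property of being $k$-edge-connected. Then the number of $(P,n)$-sinks, i.e. $|S(P,n)|$, is at least $p(k-1)$, where $p$ denotes the integer partition function.
   Context: Graphs are finite and simple. A graphical sequence of length $n$ is a nondecreasing integer sequence that is the degree sequence of some graph (a realization). For nondecreasing sequences, $\pi'\ge\pi$ ($\pi'$ majorizes $\pi$) means termwise $\ge$. A graphical sequence is forcibly $P$ if every realization has property $P$. Let $G_n$ be the poset of graphical sequences of length $n$ under majorization and $\overline{P_n}$ the subposet of those not forcibly $P$; $S(P,n)$ is the set of maximal elements of $\overline{P_n}$. $p(r)$ is the number of partitions of the integer $r$. -}

module Defs where

open import Data.Fin.Base using (Fin)
open import Data.Fin.Properties using () renaming (_≟_ to _≟ᶠ_)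
open import Data.List.Base
  using (List; []; _∷_; length; filter; map; allFin; upTo; concatMap; cartesianProductWith; sum)
open import Data.List.Membership.DecPropositional using () renaming (_∈?_ to mem?)
open import Data.List.Membership.Propositional using (_∉_)
open import Data.List.Relation.Binary.Permutation.Propositional using (_↭_)
open import Data.List.Relation.Unary.All using (All; all?)
open import Data.List.Relation.Unary.Linked using (Linked; linked?)
open import Data.Nat.Base using (ℕ; zero; suc; _≤_; _<_; _≥_)
open import Data.Nat.Properties using (_≟_; _≥?_; _<?_)
open import Data.Product.Base using (∃; _×_; _,_)
open import Data.Product.Properties using (≡-dec)
open import Data.Vec.Base using (Vec; toList)
open import Data.Vec.Relation.Binary.Pointwise.Inductive using (Pointwise)
open import Function.Definitions using (Injective)
open import Level using (Level; 0ℓ; _⊔_) renaming (suc to lsuc)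
open import Relation.Binary.Construct.Closure.ReflexiveTransitive using (Star)
open import Relation.Binary.Core using (Rel)
open import Relation.Binary.Definitions using (Decidable; Symmetric; Irreflexive)
open import Relation.Binary.PropositionalEquality using (_≡_; refl)
open import Relation.Nullary.Decidable using (_×-dec_; ¬?)
open import Relation.Nullary.Negation using (¬_)
open import Relation.Unary using (Pred) renaming (Decidable to Decidable₁)

private variable
  n : ℕ
  a ℓ : Level

record Graph (n : ℕ) : Set₁ where
  field
    _∼_    : Rel (Fin n) 0ℓ
    _∼?_   : Decidable _∼_
    sym    : Symmetric _∼_
    irrefl : Irreflexive _≡_ _∼_

  degree : Fin n → ℕ
  degree u = length (filter (u ∼?_) (allFin n))

  Connected : Set
  Connected = ∀ u v → Star _∼_ u v

-- An edge {u , v} may be listed as (u , v) or as (v , u).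
delete : Graph n → List (Fin n × Fin n) → Graph n
delete {n} G F = record
  { _∼_    = λ u v → u ∼ v × (u , v) ∉ F × (v , u) ∉ F
  ; _∼?_   = λ u v → u ∼? v ×-dec (¬? ((u , v) ∈? F) ×-dec ¬? ((v , u) ∈? F))
  ; sym    = λ (e , p , q) → sym e , q , p
  ; irrefl = λ eq (e , _) → irrefl eq e
  }
  where
  open Graph G
  _∈?_ = mem? (≡-dec (_≟ᶠ_ {n}) (_≟ᶠ_ {n}))

-- The sets of fewer than k edges are exactly the sets listed, possibly with
-- repetition, by the lists of edges of length less than k.
_EdgeConnected : ℕ → ∀ {n} → Graph n → Set
_EdgeConnected k {n} G =
  1 < n ×
  (∀ (F : List (Fin n × Fin n)) → All (λ (u , v) → u ∼ v) F →
     length F < k → Graph.Connected (delete G F))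
  where open Graph G

infix 4 _Realizes_ _⊒_

_Realizes_ : Graph n → Vec ℕ n → Set
_Realizes_ {n} G π = toList π ↭ map (Graph.degree G) (allFin n)

Graphical : Vec ℕ n → Set₁
Graphical {n} π = Linked _≤_ (toList π) × ∃ λ (G : Graph n) → G Realizes π

_⊒_ : Rel (Vec ℕ n) 0ℓ
_⊒_ = Pointwise _≥_

module _ (P : ∀ {n} → Graph n → Set) where

  Forcibly : Vec ℕ n → Set₁
  Forcibly {n} π = ∀ (G : Graph n) → G Realizes π → P G

  NotForcibly : (n : ℕ) → Pred (Vec ℕ n) (lsuc 0ℓ)
  NotForcibly n π = Graphical π × ¬ Forcibly π

  Sink : (n : ℕ) → Pred (Vec ℕ n) (lsuc 0ℓ)
  Sink n π = NotForcibly n π × (∀ π′ → NotForcibly n π′ → π′ ⊒ π → π′ ≡ π)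

infix 4 ∣_∣≥_

-- Injectivity concerns the elements only, not the proofs that they satisfy S.
∣_∣≥_ : {A : Set a} → Pred A ℓ → ℕ → Set (a ⊔ ℓ)
∣_∣≥_ {A = A} S m = ∃ λ (f : Fin m → A) → Injective _≡_ _≡_ f × (∀ i → S (f i))

IsPartition : ℕ → Pred (List ℕ) 0ℓ
IsPartition r xs = Linked _≥_ xs × All (0 <_) xs × sum xs ≡ r

isPartition? : ∀ r → Decidable₁ (IsPartition r)
isPartition? r xs = linked? _≥?_ xs ×-dec (all? (0 <?_) xs ×-dec (sum xs ≟ r))

words : List ℕ → ℕ → List (List ℕ)
words alphabet zero    = [] ∷ []
words alphabet (suc l) = cartesianProductWith _∷_ alphabet (words alphabet l)

-- A partition of r has at most r parts, each at most r, so it occurs exactly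
-- once among the words of length at most r over {0, …, r}.
partitions : ℕ → List (List ℕ)
partitions r = filter (isPartition? r) (concatMap (words (upTo (suc r))) (upTo (suc r)))

p : ℕ → ℕ
p r = length (partitions r)

_ : map p (upTo 5) ≡ 1 ∷ 1 ∷ 2 ∷ 3 ∷ 5 ∷ []
_ = refl

{-# OPTIONS --safe #-}
module Submission where

{- Let n = 2m and r = k - 1.  For a partition λ of r, join two disjoint cliques
   K_m by r edges ending in r distinct vertices of the second clique and
   distributed over the first one according to λ.  The degrees exceed m - 1 by
   λ on one side and by r ones on the other, so the degree sequence π determines
   λ, and the joining edges form a cut of size r < k.

   If π′ ≥ π has a realization with a cut of size at most r, then a side with
   s vertices satisfies s (m - 1) ≤ s (s - 1) + r because all degrees are at
   least m - 1; as r < m - 1 this forces s ≥ m.  Hence both sides have m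
   vertices, π′ has degree sum at most 2 (m (m - 1) + r), which is the degree
   sum of π, and therefore π′ = π. -}

open import Defs
open import Data.Bool.Base using (if_then_else_)
open import Data.Empty using (⊥-elim)
open import Data.Fin.Base using (Fin; zero; suc; fromℕ<; join; _↑ˡ_; _↑ʳ_; splitAt)
import Data.Fin.Properties as Fin
open import Data.Fin.Subset using (Subset; _∈_; _∉_; _∪_; ⁅_⁆; _⊃_)
open import Data.Fin.Subset.Induction using (⊃-wellFounded)
open import Data.Fin.Subset.Properties using (_∈?_; x∈⁅x⁆; x∈⁅y⁆⇒x≡y; x∈p∪q⁻; x∈p∪q⁺)
open import Data.List.Base
  using (List; []; _∷_; _++_; length; filter; map; allFin; tabulate;
    replicate; zip; take; lookup; concatMap; upTo)
import Data.List.Properties as List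
import Data.List.Membership.Propositional as ListMem
open import Data.List.Membership.Propositional.Properties using (∈-allFin; ∈-map⁺; ∈-map⁻; ∈-lookup; ∈-filter⁻)
import Data.List.Membership.DecPropositional as DecMem
open import Data.List.Relation.Binary.Permutation.Propositional using (_↭_; ↭-sym; ↭-trans; ↭-reflexive; ↭⇒↭ₛ)
import Data.List.Relation.Binary.Permutation.Propositional.Properties as Perm
open import Data.List.Relation.Binary.Pointwise using (Pointwise-≡⇒≡)
open import Data.List.Relation.Binary.Disjoint.Propositional using (Disjoint)
open import Data.List.Relation.Unary.All as All using (All; []; _∷_)
import Data.List.Relation.Unary.All.Properties as All
open import Data.List.Relation.Unary.AllPairs as AllPairs using ([]; _∷_)
import Data.List.Relation.Unary.AllPairs.Properties as AllPairs
open import Data.List.Relation.Unary.Any using (here; there)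
open import Data.List.Relation.Unary.Linked using (Linked)
open import Data.List.Relation.Unary.Sorted.TotalOrder.Properties using (↗↭↗⇒≋)
open import Data.List.Relation.Unary.Unique.Propositional using (Unique)
import Data.List.Relation.Unary.Unique.Propositional.Properties as Unique
open import Data.Nat.Base using (ℕ; zero; suc; _+_; _*_; _∸_; _≤_; _<_; _≥_; z≤n; s≤s; s≤s⁻¹)
open import Data.Nat.Divisibility using (_∣_; divides)
open import Data.Nat.ListAction using (sum)
open import Data.Nat.ListAction.Properties using (sum-++; sum-↭)
open import Data.Nat.Properties
open import Data.Nat.Solver using (module +-*-Solver)
open import Data.Product.Base using (∃₂; _×_; _,_; proj₁; proj₂; uncurry)
open import Data.Product.Properties using (≡-dec)
open import Data.Sum.Base using (_⊎_; inj₁; inj₂)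
open import Data.Vec.Base as Vec using (Vec; []; _∷_; toList)
import Data.Vec.Properties as Vec
open import Data.Vec.Relation.Binary.Pointwise.Inductive using ([]; _∷_)
open import Function.Base using (_∘_; id)
open import Function.Definitions using (Injective)
open import Induction.WellFounded using (Acc; acc)
open import Level using (Level; 0ℓ)
open import Relation.Binary.Construct.Closure.ReflexiveTransitive using (Star; ε; _◅_; _◅◅_)
import Relation.Binary.Construct.Flip.EqAndOrd as Flip
open import Relation.Binary.Core using (Rel)
open import Relation.Binary.PropositionalEquality
open import Relation.Nullary.Decidable using (Dec; yes; no; does; ¬?; _×-dec_)
open import Relation.Nullary.Negation using (¬_; contradiction)
open import Relation.Unary using (Pred; Decidable)

open import Algebra.Properties.Semiring.Sum +-*-semiring
  using (sum-cong-≗; ∑-distrib-+; *-distribˡ-sum; *-distribʳ-sum) renaming (sum to ∑)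

private variable
  a b k m n : ℕ
  ℓ : Level
  A B : Set
  P : Set ℓ

-- Finite sums and indicators

∑-mono : {f g : Fin n → ℕ} → (∀ i → f i ≤ g i) → ∑ f ≤ ∑ g
∑-mono {zero}  f≤g = z≤n
∑-mono {suc n} f≤g = +-mono-≤ (f≤g zero) (∑-mono (f≤g ∘ suc))

∑-const : ∀ n c → ∑ {n} (λ _ → c) ≡ n * c
∑-const zero    c = refl
∑-const (suc n) c = cong (c +_) (∑-const n c)

∑-split : ∀ m (f : Fin (m + n) → ℕ) → ∑ f ≡ ∑ (f ∘ (_↑ˡ n)) + ∑ (f ∘ (m ↑ʳ_))
∑-split zero    f = refl
∑-split (suc m) f = trans (cong (f zero +_) (∑-split m (f ∘ suc))) (sym (+-assoc (f zero) _ _))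

∑-suc : (f : Fin n → ℕ) → ∑ (suc ∘ f) ≡ n + ∑ f
∑-suc {n} f = trans (∑-distrib-+ (λ _ → 1) f) (cong (_+ ∑ f) (trans (∑-const n 1) (*-identityʳ n)))

sum-tabulate : (f : Fin n → ℕ) → sum (tabulate f) ≡ ∑ f
sum-tabulate {zero}  f = refl
sum-tabulate {suc n} f = cong (f zero +_) (sum-tabulate (f ∘ suc))

tabulate-split : ∀ m (f : Fin (m + n) → A) → tabulate f ≡ tabulate (f ∘ (_↑ˡ n)) ++ tabulate (f ∘ (m ↑ʳ_))
tabulate-split zero    f = refl
tabulate-split (suc m) f = cong (f zero ∷_) (tabulate-split m (f ∘ suc))

-- Only the Boolean of the decision is inspected. Hence `𝟙 (suc i Fin.≟ suc j)` and `𝟙 (i Fin.≟ j)`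
-- agree definitionally, on which the inductions over `Fin` rely.
𝟙 : Dec P → ℕ
𝟙 d = if does d then 1 else 0

𝟙-true : (d : Dec P) → P → 𝟙 d ≡ 1
𝟙-true (yes _) _ = refl
𝟙-true (no ¬p) p = contradiction p ¬p

𝟙-false : (d : Dec P) → ¬ P → 𝟙 d ≡ 0
𝟙-false (yes p) ¬p = contradiction p ¬p
𝟙-false (no _)  _  = refl

𝟙-¬ : (d : Dec P) → 𝟙 d + 𝟙 (¬? d) ≡ 1
𝟙-¬ (yes _) = refl
𝟙-¬ (no _)  = refl

∑-𝟙-≟ : (i : Fin n) → ∑ (λ j → 𝟙 (i Fin.≟ j)) ≡ 1
∑-𝟙-≟ {suc n} zero    = cong suc (trans (∑-const n 0) (*-zeroʳ n))
∑-𝟙-≟ {suc n} (suc i) = ∑-𝟙-≟ i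

1≤∑𝟙 : {S : Pred (Fin n) 0ℓ} (S? : Decidable S) → ∀ {i} → S i → 1 ≤ ∑ (𝟙 ∘ S?)
1≤∑𝟙 S? {zero}  Si = ≤-trans (≤-reflexive (sym (𝟙-true (S? zero) Si))) (m≤m+n _ _)
1≤∑𝟙 S? {suc i} Si = ≤-trans (1≤∑𝟙 (S? ∘ suc) Si) (m≤n+m _ _)

∑𝟙-complement : {S : Pred (Fin n) 0ℓ} (S? : Decidable S) → ∑ (𝟙 ∘ S?) + ∑ (𝟙 ∘ ¬? ∘ S?) ≡ n
∑𝟙-complement {n} S? = begin
  ∑ (𝟙 ∘ S?) + ∑ (𝟙 ∘ ¬? ∘ S?)        ≡⟨ ∑-distrib-+ (𝟙 ∘ S?) (𝟙 ∘ ¬? ∘ S?) ⟨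
  ∑ (λ i → 𝟙 (S? i) + 𝟙 (¬? (S? i)))  ≡⟨ sum-cong-≗ (λ i → 𝟙-¬ (S? i)) ⟩
  ∑ {n} (λ _ → 1)                     ≡⟨ ∑-const n 1 ⟩
  n * 1                               ≡⟨ *-identityʳ n ⟩
  n                                   ∎
  where open ≡-Reasoning

length-filter-tabulate : {S : Pred A ℓ} (S? : Decidable S) (f : Fin n → A) →
  length (filter S? (tabulate f)) ≡ ∑ (λ i → 𝟙 (S? (f i)))
length-filter-tabulate {n = zero}  S? f = refl
length-filter-tabulate {n = suc n} S? f with S? (f zero)
... | yes _ = cong suc (length-filter-tabulate S? (f ∘ suc))
... | no  _ = length-filter-tabulate S? (f ∘ suc)

degree-∑ : (G : Graph n) → ∀ x → Graph.degree G x ≡ ∑ (λ y → 𝟙 (Graph._∼?_ G x y))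
degree-∑ G x = length-filter-tabulate (Graph._∼?_ G x) id

-- Multiplicities in lists

occ : List (Fin n) → Fin n → ℕ
occ []       i = 0
occ (x ∷ xs) i = 𝟙 (x Fin.≟ i) + occ xs i

-- The multiplicity matrix of a list of pairs. The product of two indicators lets a sum over one
-- coordinate factor, so that row and column sums become multiplicities in the projected lists.
occ₂ : List (Fin a × Fin b) → Fin a → Fin b → ℕ
occ₂ []            i j = 0
occ₂ ((x , y) ∷ E) i j = 𝟙 (x Fin.≟ i) * 𝟙 (y Fin.≟ j) + occ₂ E i j

∑-occ : (xs : List (Fin n)) → ∑ (occ xs) ≡ length xs
∑-occ {n} []   = trans (∑-const n 0) (*-zeroʳ n)
∑-occ (x ∷ xs) = trans (∑-distrib-+ (λ i → 𝟙 (x Fin.≟ i)) (occ xs)) (cong₂ _+_ (∑-𝟙-≟ x) (∑-occ xs))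

occ-++ : (xs ys : List (Fin n)) → ∀ i → occ (xs ++ ys) i ≡ occ xs i + occ ys i
occ-++ []       ys i = refl
occ-++ (x ∷ xs) ys i = trans (cong (𝟙 (x Fin.≟ i) +_) (occ-++ xs ys i)) (sym (+-assoc (𝟙 (x Fin.≟ i)) _ _))

∑-occ₂ʳ : (E : List (Fin a × Fin b)) → ∀ i → ∑ (occ₂ E i) ≡ occ (map proj₁ E) i
∑-occ₂ʳ {b = b} [] i = trans (∑-const b 0) (*-zeroʳ b)
∑-occ₂ʳ ((x , y) ∷ E) i = begin
  ∑ (λ j → 𝟙 (x Fin.≟ i) * 𝟙 (y Fin.≟ j) + occ₂ E i j)      ≡⟨ ∑-distrib-+ (λ j → 𝟙 (x Fin.≟ i) * 𝟙 (y Fin.≟ j)) (occ₂ E i) ⟩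
  ∑ (λ j → 𝟙 (x Fin.≟ i) * 𝟙 (y Fin.≟ j)) + ∑ (occ₂ E i)    ≡⟨ cong₂ _+_ (sym (*-distribˡ-sum (𝟙 (x Fin.≟ i)) (λ j → 𝟙 (y Fin.≟ j)))) (∑-occ₂ʳ E i) ⟩
  𝟙 (x Fin.≟ i) * ∑ (λ j → 𝟙 (y Fin.≟ j)) + occ (map proj₁ E) i  ≡⟨ cong (λ t → 𝟙 (x Fin.≟ i) * t + occ (map proj₁ E) i) (∑-𝟙-≟ y) ⟩
  𝟙 (x Fin.≟ i) * 1 + occ (map proj₁ E) i                   ≡⟨ cong (_+ occ (map proj₁ E) i) (*-identityʳ (𝟙 (x Fin.≟ i))) ⟩
  𝟙 (x Fin.≟ i) + occ (map proj₁ E) i                       ∎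
  where open ≡-Reasoning

∑-occ₂ˡ : (E : List (Fin a × Fin b)) → ∀ j → ∑ (λ i → occ₂ E i j) ≡ occ (map proj₂ E) j
∑-occ₂ˡ {a = a} [] j = trans (∑-const a 0) (*-zeroʳ a)
∑-occ₂ˡ ((x , y) ∷ E) j = begin
  ∑ (λ i → 𝟙 (x Fin.≟ i) * 𝟙 (y Fin.≟ j) + occ₂ E i j)      ≡⟨ ∑-distrib-+ (λ i → 𝟙 (x Fin.≟ i) * 𝟙 (y Fin.≟ j)) (λ i → occ₂ E i j) ⟩
  ∑ (λ i → 𝟙 (x Fin.≟ i) * 𝟙 (y Fin.≟ j)) + ∑ (λ i → occ₂ E i j)  ≡⟨ cong₂ _+_ (sym (*-distribʳ-sum (𝟙 (y Fin.≟ j)) (λ i → 𝟙 (x Fin.≟ i)))) (∑-occ₂ˡ E j) ⟩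
  ∑ (λ i → 𝟙 (x Fin.≟ i)) * 𝟙 (y Fin.≟ j) + occ (map proj₂ E) j  ≡⟨ cong (λ t → t * 𝟙 (y Fin.≟ j) + occ (map proj₂ E) j) (∑-𝟙-≟ x) ⟩
  1 * 𝟙 (y Fin.≟ j) + occ (map proj₂ E) j                   ≡⟨ cong (_+ occ (map proj₂ E) j) (*-identityˡ (𝟙 (y Fin.≟ j))) ⟩
  𝟙 (y Fin.≟ j) + occ (map proj₂ E) j                       ∎
  where open ≡-Reasoning

infix 4 _∈ₗ_ _∉ₗ_ _∈ₗ?_

_∈ₗ_ _∉ₗ_ : A → List A → Set
_∈ₗ_ = ListMem._∈_
_∉ₗ_ = ListMem._∉_

_∈ₗ?_ : (e : Fin a × Fin b) (E : List (Fin a × Fin b)) → Dec (e ∈ₗ E)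
_∈ₗ?_ = DecMem._∈?_ (≡-dec Fin._≟_ Fin._≟_)

∉⇒occ₂≡0 : (E : List (Fin a × Fin b)) → ∀ {i j} → (i , j) ∉ₗ E → occ₂ E i j ≡ 0
∉⇒occ₂≡0 []            ∉E = refl
∉⇒occ₂≡0 ((x , y) ∷ E) {i} {j} ∉E with x Fin.≟ i | y Fin.≟ j
... | yes refl | yes refl = contradiction (here refl) ∉E
... | yes _    | no  _    = ∉⇒occ₂≡0 E (∉E ∘ there)
... | no  _    | _        = ∉⇒occ₂≡0 E (∉E ∘ there)

∈⇒1≤occ₂ : (E : List (Fin a × Fin b)) → ∀ {i j} → (i , j) ∈ₗ E → 1 ≤ occ₂ E i j
∈⇒1≤occ₂ (_ ∷ E) {i} {j} (here refl)
  rewrite 𝟙-true (i Fin.≟ i) refl | 𝟙-true (j Fin.≟ j) refl = s≤s z≤n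
∈⇒1≤occ₂ (_ ∷ E) (there e∈E) = ≤-trans (∈⇒1≤occ₂ E e∈E) (m≤n+m _ _)

Unique⇒occ₂≤1 : {E : List (Fin a × Fin b)} → Unique E → ∀ i j → occ₂ E i j ≤ 1
Unique⇒occ₂≤1 [] i j = z≤n
Unique⇒occ₂≤1 {E = (x , y) ∷ E} uE@(_ ∷ u) i j with x Fin.≟ i | y Fin.≟ j
... | yes refl | yes refl = ≤-reflexive (cong suc (∉⇒occ₂≡0 E (Unique.Unique[x∷xs]⇒x∉xs uE)))
... | yes _    | no  _    = Unique⇒occ₂≤1 u i j
... | no  _    | _        = Unique⇒occ₂≤1 u i j

-- Adjacency is membership, whereas the degree counts run through multiplicities; without
-- repetitions the two agree, both being 0 or 1.
Unique⇒𝟙∈≡occ₂ : {E : List (Fin a × Fin b)} → Unique E → ∀ i j → 𝟙 ((i , j) ∈ₗ? E) ≡ occ₂ E i j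
Unique⇒𝟙∈≡occ₂ {E = E} u i j with (i , j) ∈ₗ? E
... | yes e∈E = ≤-antisym (∈⇒1≤occ₂ E e∈E) (Unique⇒occ₂≤1 u i j)
... | no  e∉E = sym (∉⇒occ₂≡0 E e∉E)

-- Degree sums across a cut

-- A set of vertices reachable from `u` is enlarged by the far end of a boundary edge until it
-- contains `v`. Each enlargement is strict, so the process stops because the subsets of a finite
-- set are well-founded under `⊃`.
boundary⇒star : {R : Rel (Fin n) 0ℓ} (u v : Fin n) →
  (∀ (S : Subset n) → u ∈ S → v ∉ S → ∃₂ λ x y → x ∈ S × y ∉ S × R x y) → Star R u v
boundary⇒star {n} {R} u v boundary = grow ⁅ u ⁆ (⊃-wellFounded _) (x∈⁅x⁆ u)
  λ {x} x∈⁅u⁆ → subst (Star R u) (sym (x∈⁅y⁆⇒x≡y u x∈⁅u⁆)) ε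
  where
  grow : (S : Subset n) → Acc _⊃_ S → u ∈ S → (∀ {x} → x ∈ S → Star R u x) → Star R u v
  grow S (acc rec) u∈S reach with v ∈? S
  ... | yes v∈S = reach v∈S
  ... | no  v∉S with boundary S u∈S v∉S
  ... | x , y , x∈S , y∉S , xRy = grow (⁅ y ⁆ ∪ S)
    (rec ((λ z∈S → x∈p∪q⁺ (inj₂ z∈S)) , y , x∈p∪q⁺ (inj₁ (x∈⁅x⁆ y)) , y∉S))
    (x∈p∪q⁺ (inj₂ u∈S))
    λ z∈S∪y → reach′ (x∈p∪q⁻ ⁅ y ⁆ S z∈S∪y)
    where
    reach′ : ∀ {z} → z ∈ ⁅ y ⁆ ⊎ z ∈ S → Star R u z
    reach′ (inj₁ z∈⁅y⁆) = subst (Star R u) (sym (x∈⁅y⁆⇒x≡y y z∈⁅y⁆)) (reach x∈S ◅◅ (xRy ◅ ε))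
    reach′ (inj₂ z∈S)   = reach z∈S

module _ (G : Graph n) {S : Pred (Fin n) 0ℓ} (S? : Decidable S) where
  open Graph G using (_∼_; _∼?_; degree; irrefl)

  -- The closed neighbourhood of a vertex `x` of `S` has `suc (degree x)` elements, and each of them
  -- lies in `S` or is the far end of a pair of `E` starting at `x`. Summing over `S` gives the
  -- bound; counting `x` itself yields `s * s` in place of `s (s - 1)` and avoids subtraction.
  ∑-degree-cut : (E : List (Fin n × Fin n)) →
    (∀ {x y} → S x → ¬ S y → x ∼ y → (x , y) ∈ₗ E) →
    ∑ (λ x → 𝟙 (S? x) * suc (degree x)) ≤ ∑ (𝟙 ∘ S?) * ∑ (𝟙 ∘ S?) + length E
  ∑-degree-cut E crossing = begin
    ∑ (λ x → 𝟙 (S? x) * suc (degree x))             ≤⟨ ∑-mono pointwise ⟩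
    ∑ (λ x → 𝟙 (S? x) * s + occ (map proj₁ E) x)    ≡⟨ ∑-distrib-+ (λ x → 𝟙 (S? x) * s) (occ (map proj₁ E)) ⟩
    ∑ (λ x → 𝟙 (S? x) * s) + ∑ (occ (map proj₁ E))  ≡⟨ cong₂ _+_ (sym (*-distribʳ-sum s (𝟙 ∘ S?))) (∑-occ (map proj₁ E)) ⟩
    s * s + length (map proj₁ E)                    ≡⟨ cong (s * s +_) (List.length-map proj₁ E) ⟩
    s * s + length E                                ∎
    where
    open ≤-Reasoning
    s = ∑ (𝟙 ∘ S?)

    entry : ∀ {x} → S x → ∀ y → 𝟙 (x Fin.≟ y) + 𝟙 (x ∼? y) ≤ 𝟙 (S? y) + occ₂ E x y
    entry {x} Sx y with x Fin.≟ y | x ∼? y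
    ... | yes x≡y  | yes x∼y = contradiction x∼y (irrefl x≡y)
    ... | yes refl | no  _   = ≤-trans (≤-reflexive (sym (𝟙-true (S? y) Sx))) (m≤m+n _ _)
    ... | no  _    | no  _   = z≤n
    ... | no  _    | yes x∼y with S? y
    ...   | yes _  = s≤s z≤n
    ...   | no ¬Sy = ∈⇒1≤occ₂ E (crossing Sx ¬Sy x∼y)

    row : ∀ {x} → S x → suc (degree x) ≤ s + occ (map proj₁ E) x
    row {x} Sx = begin
      1 + degree x                                        ≡⟨ cong₂ _+_ (sym (∑-𝟙-≟ x)) (degree-∑ G x) ⟩
      ∑ (λ y → 𝟙 (x Fin.≟ y)) + ∑ (λ y → 𝟙 (x ∼? y))      ≡⟨ ∑-distrib-+ (λ y → 𝟙 (x Fin.≟ y)) (λ y → 𝟙 (x ∼? y)) ⟨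
      ∑ (λ y → 𝟙 (x Fin.≟ y) + 𝟙 (x ∼? y))                ≤⟨ ∑-mono (entry Sx) ⟩
      ∑ (λ y → 𝟙 (S? y) + occ₂ E x y)                     ≡⟨ ∑-distrib-+ (𝟙 ∘ S?) (occ₂ E x) ⟩
      s + ∑ (occ₂ E x)                                    ≡⟨ cong (s +_) (∑-occ₂ʳ E x) ⟩
      s + occ (map proj₁ E) x                             ∎

    pointwise : ∀ x → 𝟙 (S? x) * suc (degree x) ≤ 𝟙 (S? x) * s + occ (map proj₁ E) x
    pointwise x with S? x
    ... | no  _  = z≤n
    ... | yes Sx = subst₂ (λ c d → c ≤ d + occ (map proj₁ E) x) (sym (+-identityʳ _)) (sym (+-identityʳ s)) (row Sx)

module _ {S : Pred (Fin n) 0ℓ} (S? : Decidable S) where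

  -- Deleted edges may be listed in either direction, while `∑-degree-cut` expects the end in `S`
  -- first. Pairs that do not cross may come out either way round; only the length of the list
  -- matters for them.
  orient : Fin n × Fin n → Fin n × Fin n
  orient (x , y) = if does (S? x) then (x , y) else (y , x)

  orient-∈ : ∀ {F x y} → S x → ¬ S y → (x , y) ∈ₗ F ⊎ (y , x) ∈ₗ F → (x , y) ∈ₗ map orient F
  orient-∈ {F} {x} {y} Sx ¬Sy (inj₁ xy∈F) = subst (_∈ₗ map orient F) eq (∈-map⁺ orient xy∈F)
    where
    eq : orient (x , y) ≡ (x , y)
    eq with S? x
    ... | yes _  = refl
    ... | no ¬Sx = contradiction Sx ¬Sx
  orient-∈ {F} {x} {y} Sx ¬Sy (inj₂ yx∈F) = subst (_∈ₗ map orient F) eq (∈-map⁺ orient yx∈F)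
    where
    eq : orient (y , x) ≡ (x , y)
    eq with S? y
    ... | yes Sy = contradiction Sy ¬Sy
    ... | no _   = refl

-- Edge connectivity from a large degree sum

small-cut⇒m≤s : ∀ s m r → 1 ≤ s → 2 + r ≤ m → s * m ≤ s * s + r → m ≤ s
small-cut⇒m≤s (suc s) m r _ 2+r≤m sm≤ss+r with m ≤? suc s
... | yes m≤s = m≤s
... | no  m≰s with m≤n⇒∃[o]m+o≡n (≰⇒> m≰s)
... | e , refl = contradiction r<r (<-irrefl refl)
  where
  open ≤-Reasoning
  -- If the side, of size `suc s`, were smaller than `m`, then `m` would be `suc s + suc e`, and
  -- cancelling the square leaves this inequality. But a product of positive numbers `x * y` is at
  -- least `x + y - 1`, here `m - 1`, which exceeds `r`.
  s·e≤r : suc s * suc e ≤ r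
  s·e≤r = +-cancelˡ-≤ (suc s * suc s) _ _ (begin
    suc s * suc s + suc s * suc e  ≡⟨ *-distribˡ-+ (suc s) (suc s) (suc e) ⟨
    suc s * (suc s + suc e)        ≡⟨ cong (suc s *_) (+-suc (suc s) e) ⟩
    suc s * (2 + s + e)            ≤⟨ sm≤ss+r ⟩
    suc s * suc s + r              ∎)
  r<r : suc r ≤ r
  r<r = begin
    suc r              ≤⟨ s≤s⁻¹ 2+r≤m ⟩
    suc s + e          ≡⟨ +-comm (suc s) e ⟩
    e + suc s          ≡⟨ +-suc e s ⟩
    suc e + s          ≤⟨ +-monoʳ-≤ (suc e) (m≤m*n s (suc e)) ⟩
    suc e + s * suc e  ≤⟨ s·e≤r ⟩
    r                  ∎

-- If at most `r` edges separated the graph, each side would have at least `m` vertices by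
-- `small-cut⇒m≤s`, hence exactly `m`. The two cut inequalities would then bound the sum of all
-- `suc (degree x)` by `2 (m * m + r)`, against the density hypothesis.
dense⇒edgeConnected : ∀ m r → 2 + r ≤ m → (G : Graph (m + m)) →
  (∀ x → m ≤ suc (Graph.degree G x)) →
  (m * m + r) + (m * m + r) < ∑ (suc ∘ Graph.degree G) →
  (suc r EdgeConnected) G
dense⇒edgeConnected m r 2+r≤m G m≤1+deg dense = 1<m+m , connected
  where
  open Graph G using (_∼_; _∼?_; degree)
  open ≤-Reasoning

  1<m+m : 1 < m + m
  1<m+m = ≤-trans (≤-trans (s≤s (s≤s z≤n)) 2+r≤m) (m≤m+n m m)

  module _ (F : List (Fin (m + m) × Fin (m + m))) (|F|≤r : length F ≤ r) where
    G∖F = delete G F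

    module _ {S : Pred (Fin (m + m)) 0ℓ} (S? : Decidable S) where
      cut-bound : (∀ {x y} → S x → ¬ S y → x ∼ y → (x , y) ∈ₗ F ⊎ (y , x) ∈ₗ F) →
        ∑ (λ x → 𝟙 (S? x) * suc (degree x)) ≤ ∑ (𝟙 ∘ S?) * ∑ (𝟙 ∘ S?) + r
      cut-bound crossing = ≤-trans
        (∑-degree-cut G S? (map (orient S?) F) (λ Sx ¬Sy x∼y → orient-∈ S? Sx ¬Sy (crossing Sx ¬Sy x∼y)))
        (+-monoʳ-≤ (∑ (𝟙 ∘ S?) * ∑ (𝟙 ∘ S?)) (≤-trans (≤-reflexive (List.length-map (orient S?) F)) |F|≤r))

      degree-bound : ∑ (𝟙 ∘ S?) * m ≤ ∑ (λ x → 𝟙 (S? x) * suc (degree x))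
      degree-bound = ≤-trans (≤-reflexive (*-distribʳ-sum m (𝟙 ∘ S?)))
        (∑-mono (λ x → *-monoʳ-≤ (𝟙 (S? x)) (m≤1+deg x)))

    no-cut : {S : Pred (Fin (m + m)) 0ℓ} (S? : Decidable S) {u v : Fin (m + m)} → S u → ¬ S v →
      ¬ (∀ {x y} → S x → ¬ S y → x ∼ y → (x , y) ∈ₗ F ⊎ (y , x) ∈ₗ F)
    no-cut {S} S? Su ¬Sv crossing = <⇒≱ dense (begin
      ∑ (suc ∘ degree)                                  ≡⟨ sum-cong-≗ split ⟩
      ∑ (λ x → 𝟙 (S? x) * suc (degree x) + 𝟙 (S?ᶜ x) * suc (degree x))
        ≡⟨ ∑-distrib-+ (λ x → 𝟙 (S? x) * suc (degree x)) (λ x → 𝟙 (S?ᶜ x) * suc (degree x)) ⟩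
      ∑ (λ x → 𝟙 (S? x) * suc (degree x)) + ∑ (λ x → 𝟙 (S?ᶜ x) * suc (degree x))  ≤⟨ +-mono-≤ bound-s bound-t ⟩
      (s * s + r) + (t * t + r)                         ≡⟨ cong₂ (λ x y → (x * x + r) + (y * y + r)) s≡m t≡m ⟩
      (m * m + r) + (m * m + r)                         ∎)
      where
      S?ᶜ : Decidable (¬_ ∘ S)
      S?ᶜ = ¬? ∘ S?
      s = ∑ (𝟙 ∘ S?)
      t = ∑ (𝟙 ∘ S?ᶜ)

      -- The same cut seen from the other side: the roles of the two ends are exchanged, and so are
      -- the two alternatives for how `F` lists the edge.
      crossingᶜ : ∀ {x y} → ¬ S x → ¬ ¬ S y → x ∼ y → (x , y) ∈ₗ F ⊎ (y , x) ∈ₗ F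
      crossingᶜ {x} {y} ¬Sx ¬¬Sy x∼y with S? y
      ... | no ¬Sy = contradiction ¬Sy ¬¬Sy
      ... | yes Sy with crossing Sy ¬Sx (Graph.sym G x∼y)
      ...   | inj₁ yx∈F = inj₂ yx∈F
      ...   | inj₂ xy∈F = inj₁ xy∈F

      split : ∀ x → suc (degree x) ≡ 𝟙 (S? x) * suc (degree x) + 𝟙 (S?ᶜ x) * suc (degree x)
      split x = sym (trans (sym (*-distribʳ-+ (suc (degree x)) (𝟙 (S? x)) (𝟙 (S?ᶜ x))))
        (trans (cong (_* suc (degree x)) (𝟙-¬ (S? x))) (+-identityʳ _)))

      bound-s = cut-bound S? crossing
      bound-t = cut-bound S?ᶜ crossingᶜ

      s+t≡m+m : s + t ≡ m + m
      s+t≡m+m = ∑𝟙-complement S?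

      -- The vertices `u` and `v` show that neither side is empty, which excludes the trivial
      -- solution `s = 0` of the cut inequality.
      m≤s : m ≤ s
      m≤s = small-cut⇒m≤s s m r (1≤∑𝟙 S? Su) 2+r≤m (≤-trans (degree-bound S?) bound-s)

      m≤t : m ≤ t
      m≤t = small-cut⇒m≤s t m r (1≤∑𝟙 S?ᶜ ¬Sv) 2+r≤m (≤-trans (degree-bound S?ᶜ) bound-t)

      s≡m : s ≡ m
      s≡m = ≤-antisym (+-cancelʳ-≤ m s m (≤-trans (+-monoʳ-≤ s m≤t) (≤-reflexive s+t≡m+m))) m≤s

      t≡m : t ≡ m
      t≡m = ≤-antisym (+-cancelˡ-≤ m t m (≤-trans (+-monoˡ-≤ t m≤s) (≤-reflexive s+t≡m+m))) m≤t

    boundary : (S : Subset (m + m)) → ∀ {u v} → u ∈ S → v ∉ S →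
      ∃₂ λ x y → x ∈ S × y ∉ S × Graph._∼_ G∖F x y
    boundary S u∈S v∉S
      with Fin.any? (λ x → Fin.any? (λ y → x ∈? S ×-dec ¬? (y ∈? S) ×-dec Graph._∼?_ G∖F x y))
    ... | yes found = found
    -- If the finite search finds no edge leaving `S` in `G∖F`, then every edge of `G` leaving `S`
    -- was deleted, so `F` contains the whole cut.
    ... | no  none  = ⊥-elim (no-cut (_∈? S) u∈S v∉S crossing)
      where
      crossing : ∀ {x y} → x ∈ S → y ∉ S → x ∼ y → (x , y) ∈ₗ F ⊎ (y , x) ∈ₗ F
      crossing {x} {y} x∈S y∉S x∼y with (x , y) ∈ₗ? F | (y , x) ∈ₗ? F
      ... | yes xy∈F | _        = inj₁ xy∈F
      ... | no  _    | yes yx∈F = inj₂ yx∈F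
      ... | no xy∉F  | no yx∉F  = contradiction (x , y , x∈S , y∉S , x∼y , xy∉F , yx∉F) none

  connected : ∀ F → All (uncurry _∼_) F → length F < suc r → Graph.Connected (delete G F)
  connected F _ |F|<1+r u v = boundary⇒star u v (λ S → boundary F (s≤s⁻¹ |F|<1+r) S)

-- Degree sequences

module _ (G : Graph n) where
  open Graph G using (degree)
  open import Data.List.Sort ≤-decTotalOrder using (sort; sort-↭; sort-↗)

  private
    degrees = map degree (allFin n)

    length-sort : length (sort degrees) ≡ n
    length-sort = trans (Perm.↭-length (sort-↭ degrees))
      (trans (List.length-map degree (allFin n)) (List.length-tabulate id))

  degreeSequence : Vec ℕ n
  degreeSequence = Vec.cast length-sort (Vec.fromList (sort degrees))

  private
    toList-degreeSequence : toList degreeSequence ≡ sort degrees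
    toList-degreeSequence = trans (Vec.toList-cast length-sort _) (Vec.toList∘fromList (sort degrees))

  realizes-degreeSequence : G Realizes degreeSequence
  realizes-degreeSequence = ↭-trans (↭-reflexive toList-degreeSequence) (sort-↭ degrees)

  graphical-degreeSequence : Graphical degreeSequence
  graphical-degreeSequence =
    subst (Linked _≤_) (sym toList-degreeSequence) (sort-↗ degrees) , G , realizes-degreeSequence

module _ (G : Graph n) (π : Vec ℕ n) (G⊢π : G Realizes π) where
  open Graph G using (degree)

  realizes-sum : sum (toList π) ≡ ∑ degree
  realizes-sum = trans (sum-↭ G⊢π) (trans (cong sum (List.map-tabulate id degree)) (sum-tabulate degree))

  realizes-all⁺ : {S : Pred ℕ 0ℓ} → (∀ x → S (degree x)) → All S (toList π)
  realizes-all⁺ S-deg = Perm.All-resp-↭ (↭-sym G⊢π) (All.map⁺ (All.universal S-deg (allFin n)))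

  realizes-all⁻ : {S : Pred ℕ 0ℓ} → All S (toList π) → ∀ x → S (degree x)
  realizes-all⁻ Sπ x = All.lookup (All.map⁻ (Perm.All-resp-↭ G⊢π Sπ)) (∈-allFin x)

-- Two cliques joined by a set of edges

module TwoCliques (m : ℕ) (E : List (Fin m × Fin m)) (E! : Unique E) where

  -- Adjacency is defined on the disjoint union, where the side of a vertex is visible to pattern
  -- matching; `splitAt` transports it to `Fin (m + m)`.
  Joined : Rel (Fin m ⊎ Fin m) 0ℓ
  Joined (inj₁ i) (inj₁ i′) = i ≢ i′
  Joined (inj₁ i) (inj₂ j)  = (i , j) ∈ₗ E
  Joined (inj₂ j) (inj₁ i)  = (i , j) ∈ₗ E
  Joined (inj₂ j) (inj₂ j′) = j ≢ j′

  joined? : ∀ x y → Dec (Joined x y)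
  joined? (inj₁ i) (inj₁ i′) = ¬? (i Fin.≟ i′)
  joined? (inj₁ i) (inj₂ j)  = (i , j) ∈ₗ? E
  joined? (inj₂ j) (inj₁ i)  = (i , j) ∈ₗ? E
  joined? (inj₂ j) (inj₂ j′) = ¬? (j Fin.≟ j′)

  joined-sym : ∀ x y → Joined x y → Joined y x
  joined-sym (inj₁ _) (inj₁ _) = ≢-sym
  joined-sym (inj₁ _) (inj₂ _) = id
  joined-sym (inj₂ _) (inj₁ _) = id
  joined-sym (inj₂ _) (inj₂ _) = ≢-sym

  joined-irrefl : ∀ x → ¬ Joined x x
  joined-irrefl (inj₁ _) i≢i = i≢i refl
  joined-irrefl (inj₂ _) j≢j = j≢j refl

  graph : Graph (m + m)
  graph = record
    { _∼_    = λ x y → Joined (splitAt m x) (splitAt m y)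
    ; _∼?_   = λ x y → joined? (splitAt m x) (splitAt m y)
    ; sym    = λ {x} {y} → joined-sym (splitAt m x) (splitAt m y)
    ; irrefl = λ { {x} refl → joined-irrefl (splitAt m x) }
    }

  open Graph graph using (_∼_; degree)

  degree-split : ∀ {x s} → splitAt m x ≡ s →
    degree x ≡ ∑ (λ i → 𝟙 (joined? s (inj₁ i))) + ∑ (λ j → 𝟙 (joined? s (inj₂ j)))
  degree-split {x} refl = begin
    degree x                                              ≡⟨ degree-∑ graph x ⟩
    ∑ (λ y → 𝟙 (joined? (splitAt m x) (splitAt m y)))     ≡⟨ ∑-split m (λ y → 𝟙 (joined? (splitAt m x) (splitAt m y))) ⟩
    ∑ (λ i → 𝟙 (joined? (splitAt m x) (splitAt m (i ↑ˡ m)))) + ∑ (λ j → 𝟙 (joined? (splitAt m x) (splitAt m (m ↑ʳ j))))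
      ≡⟨ cong₂ _+_ (sum-cong-≗ (λ i → cong (𝟙 ∘ joined? (splitAt m x)) (Fin.splitAt-↑ˡ m i m)))
                   (sum-cong-≗ (λ j → cong (𝟙 ∘ joined? (splitAt m x)) (Fin.splitAt-↑ʳ m m j))) ⟩
    ∑ (λ i → 𝟙 (joined? (splitAt m x) (inj₁ i))) + ∑ (λ j → 𝟙 (joined? (splitAt m x) (inj₂ j)))  ∎
    where open ≡-Reasoning

  clique-degree : (i : Fin m) → suc (∑ (λ i′ → 𝟙 (¬? (i Fin.≟ i′)))) ≡ m
  clique-degree i = trans (cong (_+ ∑ (λ i′ → 𝟙 (¬? (i Fin.≟ i′)))) (sym (∑-𝟙-≟ i))) (∑𝟙-complement (i Fin.≟_))

  -- With the vertex itself counted, its own clique contributes exactly `m`; the rest is the number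
  -- of joining edges at it, a row sum of the multiplicity matrix.
  degree-↑ˡ : ∀ i → suc (degree (i ↑ˡ m)) ≡ m + occ (map proj₁ E) i
  degree-↑ˡ i = trans (cong suc (degree-split (Fin.splitAt-↑ˡ m i m)))
    (cong₂ _+_ (clique-degree i) (trans (sum-cong-≗ (Unique⇒𝟙∈≡occ₂ E! i)) (∑-occ₂ʳ E i)))

  degree-↑ʳ : ∀ j → suc (degree (m ↑ʳ j)) ≡ m + occ (map proj₂ E) j
  degree-↑ʳ j = begin
    suc (degree (m ↑ʳ j))  ≡⟨ cong suc (trans (degree-split (Fin.splitAt-↑ʳ m m j)) (+-comm cross same)) ⟩
    suc same + cross       ≡⟨ cong₂ _+_ (clique-degree j) (trans (sum-cong-≗ (λ i → Unique⇒𝟙∈≡occ₂ E! i j)) (∑-occ₂ˡ E j)) ⟩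
    m + occ (map proj₂ E) j  ∎
    where
    open ≡-Reasoning
    cross = ∑ (λ i → 𝟙 ((i , j) ∈ₗ? E))
    same  = ∑ (λ j′ → 𝟙 (¬? (j Fin.≟ j′)))

  m≤1+degree : ∀ x → m ≤ suc (degree x)
  m≤1+degree x = subst (λ y → m ≤ suc (degree y)) (Fin.join-splitAt m m x) (bound (splitAt m x))
    where
    bound : ∀ s → m ≤ suc (degree (join m m s))
    bound (inj₁ i) = ≤-trans (m≤m+n m _) (≤-reflexive (sym (degree-↑ˡ i)))
    bound (inj₂ j) = ≤-trans (m≤m+n m _) (≤-reflexive (sym (degree-↑ʳ j)))

  -- Each joining edge is counted once on either side. With `length E` equal to `r`, this is
  -- precisely the threshold that `dense⇒edgeConnected` asks to be exceeded.
  ∑-degree : ∑ (suc ∘ degree) ≡ (m * m + length E) + (m * m + length E)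
  ∑-degree = trans (∑-split m (suc ∘ degree)) (cong₂ _+_
    (side (map proj₁ E) (List.length-map proj₁ E) degree-↑ˡ)
    (side (map proj₂ E) (List.length-map proj₂ E) degree-↑ʳ))
    where
    side : {f : Fin m → ℕ} (xs : List (Fin m)) → length xs ≡ length E →
      (∀ i → f i ≡ m + occ xs i) → ∑ f ≡ m * m + length E
    side {f} xs eq f≗ = begin
      ∑ f                     ≡⟨ sum-cong-≗ f≗ ⟩
      ∑ (λ i → m + occ xs i)  ≡⟨ ∑-distrib-+ (λ _ → m) (occ xs) ⟩
      ∑ {m} (λ _ → m) + ∑ (occ xs)  ≡⟨ cong₂ _+_ (∑-const m m) (trans (∑-occ xs) eq) ⟩
      m * m + length E        ∎
      where open ≡-Reasoning

  -- The number of joining edges at each vertex, that is, the surplus of its degree over `m - 1`.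
  -- This is the part of the degree sequence that remembers `E`.
  excesses : List ℕ
  excesses = tabulate (occ (map proj₁ E)) ++ tabulate (occ (map proj₂ E))

  degrees⇒excesses : map (λ d → suc d ∸ m) (map degree (allFin (m + m))) ≡ excesses
  degrees⇒excesses = begin
    map excess (map degree (allFin (m + m)))  ≡⟨ cong (map excess) (List.map-tabulate id degree) ⟩
    map excess (tabulate degree)              ≡⟨ List.map-tabulate degree excess ⟩
    tabulate (excess ∘ degree)                ≡⟨ tabulate-split m (excess ∘ degree) ⟩
    tabulate (excess ∘ degree ∘ (_↑ˡ m)) ++ tabulate (excess ∘ degree ∘ (m ↑ʳ_))
      ≡⟨ cong₂ _++_ (List.tabulate-cong (λ i → trans (cong (_∸ m) (degree-↑ˡ i)) (m+n∸m≡n m _)))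
                    (List.tabulate-cong (λ j → trans (cong (_∸ m) (degree-↑ʳ j)) (m+n∸m≡n m _))) ⟩
    excesses  ∎
    where
    open ≡-Reasoning
    excess : ℕ → ℕ
    excess d = suc d ∸ m

  degreeSequence⇒excesses : map (λ d → suc d ∸ m) (toList (degreeSequence graph)) ↭ excesses
  degreeSequence⇒excesses = ↭-trans (Perm.map⁺ _ (realizes-degreeSequence graph)) (↭-reflexive degrees⇒excesses)

  -- Deleting all of `E` leaves no path between the cliques. The argument of type `Fin m` provides a
  -- vertex on each side to be separated.
  ¬edgeConnected : Fin m → length E < k → ¬ (k EdgeConnected) graph
  ¬edgeConnected i |E|<k (_ , connected) = stuck i
    (connected F (All.tabulate F⊆graph) (≤-trans (s≤s (≤-reflexive (List.length-map emb E))) |E|<k) (i ↑ˡ m) (m ↑ʳ i))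
    where
    emb : Fin m × Fin m → Fin (m + m) × Fin (m + m)
    emb (i , j) = i ↑ˡ m , m ↑ʳ j

    F = map emb E

    F⊆graph : ∀ {e} → e ∈ₗ F → proj₁ e ∼ proj₂ e
    F⊆graph e∈F with ∈-map⁻ emb e∈F
    ... | (i , j) , ij∈E , refl rewrite Fin.splitAt-↑ˡ m i m | Fin.splitAt-↑ʳ m m j = ij∈E

    -- The start ranges over all left vertices, so that the induction on the path survives steps
    -- inside the left clique. The first step to the right would have to use a deleted edge.
    stuck′ : ∀ {x y i} → splitAt m x ≡ inj₁ i → ∀ {j} → splitAt m y ≡ inj₂ j →
      ¬ Star (Graph._∼_ (delete graph F)) x y
    stuck′ ex ey ε with trans (sym ex) ey
    ... | ()
    stuck′ {x} ex ey (_◅_ {j = z} (x∼z , xz∉F , _) z⇝y) with splitAt m z in ez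
    ... | inj₁ _ = stuck′ ez ey z⇝y
    ... | inj₂ j = xz∉F (subst₂ (λ x z → (x , z) ∈ₗ F) (Fin.splitAt⁻¹-↑ˡ ex) (Fin.splitAt⁻¹-↑ʳ ez)
      (∈-map⁺ emb (subst (λ s → Joined s (inj₂ j)) ex x∼z)))

    stuck : ∀ i → ¬ Star (Graph._∼_ (delete graph F)) (i ↑ˡ m) (m ↑ʳ i)
    stuck i = stuck′ (Fin.splitAt-↑ˡ m i m) (Fin.splitAt-↑ʳ m m i)

-- Sinks

⊒-all : ∀ {π π′ : Vec ℕ n} → π′ ⊒ π → All (λ d → m ≤ suc d) (toList π) → All (λ d → m ≤ suc d) (toList π′)
⊒-all []               []         = []
⊒-all (d′≥d ∷ π′⊒π) (m≤d ∷ m≤π) = ≤-trans m≤d (s≤s d′≥d) ∷ ⊒-all π′⊒π m≤π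

⊒-sum : ∀ {π π′ : Vec ℕ n} → π′ ⊒ π → sum (toList π) ≤ sum (toList π′)
⊒-sum []             = z≤n
⊒-sum (d′≥d ∷ π′⊒π) = +-mono-≤ d′≥d (⊒-sum π′⊒π)

-- All termwise differences are nonnegative and their total is not positive, so each of them
-- vanishes.
⊒-sum-≤⇒≡ : ∀ {π π′ : Vec ℕ n} → π′ ⊒ π → sum (toList π′) ≤ sum (toList π) → π′ ≡ π
⊒-sum-≤⇒≡ [] _ = refl
⊒-sum-≤⇒≡ {π = d ∷ π} {d′ ∷ π′} (d′≥d ∷ π′⊒π) ∑′≤∑ = cong₂ _∷_
  (≤-antisym (+-cancelʳ-≤ (sum (toList π)) d′ d (≤-trans (+-monoʳ-≤ d′ (⊒-sum π′⊒π)) ∑′≤∑)) d′≥d)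
  (⊒-sum-≤⇒≡ π′⊒π (+-cancelˡ-≤ d _ _ (≤-trans (+-monoˡ-≤ _ d′≥d) ∑′≤∑)))

module _ {r m : ℕ} (2+r≤m : 2 + r ≤ m)
  {E : List (Fin m × Fin m)} (E! : Unique E) (|E|≡r : length E ≡ r) where

  open TwoCliques m E E!
  open Graph graph using (degree)

  twoCliques-sink : Sink (suc r EdgeConnected) (m + m) (degreeSequence graph)
  twoCliques-sink = (graphical-degreeSequence graph , ¬forcibly) , maximal
    where
    π = degreeSequence graph

    ¬forcibly : ¬ Forcibly (suc r EdgeConnected) π
    ¬forcibly forcibly = ¬edgeConnected (fromℕ< (≤-trans (s≤s z≤n) 2+r≤m)) (s≤s (≤-reflexive |E|≡r))
      (forcibly graph (realizes-degreeSequence graph))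

    maximal : ∀ π′ → NotForcibly (suc r EdgeConnected) (m + m) π′ → π′ ⊒ π → π′ ≡ π
    -- A strictly larger sum puts every realization of `π′` above the density threshold, so `π′`
    -- would be forcibly edge-connected. Otherwise the sums leave no room for a proper increase.
    maximal π′ (_ , ¬forcibly′) π′⊒π with sum (toList π′) ≤? sum (toList π)
    ... | yes ∑π′≤∑π = ⊒-sum-≤⇒≡ π′⊒π ∑π′≤∑π
    ... | no  ∑π′≰∑π = contradiction forcibly′ ¬forcibly′
      where
      open ≤-Reasoning
      forcibly′ : Forcibly (suc r EdgeConnected) π′
      forcibly′ G G⊢π′ = dense⇒edgeConnected m r 2+r≤m G
        (realizes-all⁻ G π′ G⊢π′ (⊒-all π′⊒π (realizes-all⁺ graph π (realizes-degreeSequence graph) m≤1+degree)))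
        (begin-strict
          (m * m + r) + (m * m + r)                ≡⟨ cong (λ r → (m * m + r) + (m * m + r)) |E|≡r ⟨
          (m * m + length E) + (m * m + length E)  ≡⟨ ∑-degree ⟨
          ∑ (suc ∘ degree)                         ≡⟨ ∑-suc degree ⟩
          (m + m) + ∑ degree                       ≡⟨ cong ((m + m) +_) (realizes-sum graph π (realizes-degreeSequence graph)) ⟨
          (m + m) + sum (toList π)                 <⟨ +-monoʳ-< (m + m) (≰⇒> ∑π′≰∑π) ⟩
          (m + m) + sum (toList π′)                ≡⟨ cong ((m + m) +_) (realizes-sum G π′ G⊢π′) ⟩
          (m + m) + ∑ (Graph.degree G)             ≡⟨ ∑-suc (Graph.degree G) ⟨
          ∑ (suc ∘ Graph.degree G)                 ∎)

-- Partitions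

-- A list of left endpoints with prescribed multiplicities; `occ-blocks` confirms that it has them.
blocks : (Fin n → ℕ) → List (Fin n)
blocks {zero}  f = []
blocks {suc n} f = replicate (f zero) zero ++ map suc (blocks (f ∘ suc))

length-blocks : (f : Fin n → ℕ) → length (blocks f) ≡ ∑ f
length-blocks {zero}  f = refl
length-blocks {suc n} f = trans (List.length-++ (replicate (f zero) zero)) (cong₂ _+_
  (List.length-replicate (f zero)) (trans (List.length-map suc (blocks (f ∘ suc))) (length-blocks (f ∘ suc))))

occ-replicate-zero : ∀ c (i : Fin (suc n)) → occ (replicate c zero) i ≡ c * 𝟙 (zero Fin.≟ i)
occ-replicate-zero zero    i = refl
occ-replicate-zero (suc c) i = cong (𝟙 (zero Fin.≟ i) +_) (occ-replicate-zero c i)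

occ-map-suc-zero : (xs : List (Fin n)) → occ (map suc xs) zero ≡ 0
occ-map-suc-zero []       = refl
occ-map-suc-zero (x ∷ xs) = occ-map-suc-zero xs

occ-map-suc : (xs : List (Fin n)) → ∀ i → occ (map suc xs) (suc i) ≡ occ xs i
occ-map-suc []       i = refl
occ-map-suc (x ∷ xs) i = cong (𝟙 (x Fin.≟ i) +_) (occ-map-suc xs i)

occ-blocks : (f : Fin n → ℕ) → ∀ i → occ (blocks f) i ≡ f i
occ-blocks {suc n} f zero = begin
  occ (blocks f) zero  ≡⟨ occ-++ (replicate (f zero) zero) _ zero ⟩
  occ (replicate (f zero) zero) zero + occ (map suc (blocks (f ∘ suc))) zero
    ≡⟨ cong₂ _+_ (occ-replicate-zero (f zero) zero) (occ-map-suc-zero (blocks (f ∘ suc))) ⟩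
  f zero * 1 + 0       ≡⟨ trans (+-identityʳ _) (*-identityʳ _) ⟩
  f zero               ∎
  where open ≡-Reasoning
occ-blocks {suc n} f (suc i) = begin
  occ (blocks f) (suc i)  ≡⟨ occ-++ (replicate (f zero) zero) _ (suc i) ⟩
  occ (replicate (f zero) zero) (suc i) + occ (map suc (blocks (f ∘ suc))) (suc i)
    ≡⟨ cong₂ _+_ (occ-replicate-zero (f zero) (suc i)) (trans (occ-map-suc (blocks (f ∘ suc)) i) (occ-blocks (f ∘ suc) i)) ⟩
  f zero * 0 + f (suc i)  ≡⟨ cong (_+ f (suc i)) (*-zeroʳ (f zero)) ⟩
  f (suc i)               ∎
  where open ≡-Reasoning

-- Extends the parts by zeros to one number per vertex. Parts beyond position `n` would be lost,
-- hence the length hypotheses in what follows.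
pad : List ℕ → Fin n → ℕ
pad []       _       = 0
pad (x ∷ xs) zero    = x
pad (x ∷ xs) (suc i) = pad xs i

tabulate-pad : ∀ xs → length xs ≤ m → tabulate {n = m} (pad xs) ≡ xs ++ replicate (m ∸ length xs) 0
tabulate-pad {zero}  []       _         = refl
tabulate-pad {suc m} []       _         = cong (0 ∷_) (tabulate-pad {m} [] z≤n)
tabulate-pad {suc m} (x ∷ xs) (s≤s |xs|≤m) = cong (x ∷_) (tabulate-pad xs |xs|≤m)

sum-replicate-0 : ∀ c → sum (replicate c 0) ≡ 0
sum-replicate-0 zero    = refl
sum-replicate-0 (suc c) = sum-replicate-0 c

∑-pad : ∀ xs → length xs ≤ m → ∑ {m} (pad xs) ≡ sum xs
∑-pad {m} xs |xs|≤m = begin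
  ∑ {m} (pad xs)                              ≡⟨ sum-tabulate {m} (pad xs) ⟨
  sum (tabulate {n = m} (pad xs))             ≡⟨ cong sum (tabulate-pad xs |xs|≤m) ⟩
  sum (xs ++ replicate (m ∸ length xs) 0)     ≡⟨ sum-++ xs _ ⟩
  sum xs + sum (replicate (m ∸ length xs) 0)  ≡⟨ cong (sum xs +_) (sum-replicate-0 (m ∸ length xs)) ⟩
  sum xs + 0                                  ≡⟨ +-identityʳ _ ⟩
  sum xs                                      ∎
  where open ≡-Reasoning

-- Since parts are positive, discarding zeros removes the padding and nothing else.
filter-pad : ∀ {xs} → length xs ≤ m → All (0 <_) xs → filter (0 <?_) (tabulate {n = m} (pad xs)) ≡ xs
filter-pad {m} {xs} |xs|≤m pos = begin
  filter (0 <?_) (tabulate {n = m} (pad xs))                 ≡⟨ cong (filter (0 <?_)) (tabulate-pad xs |xs|≤m) ⟩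
  filter (0 <?_) (xs ++ replicate (m ∸ length xs) 0)         ≡⟨ List.filter-++ (0 <?_) xs _ ⟩
  filter (0 <?_) xs ++ filter (0 <?_) (replicate (m ∸ length xs) 0)
    ≡⟨ cong₂ _++_ (List.filter-all (0 <?_) pos) (List.filter-none (0 <?_) (All.replicate⁺ (m ∸ length xs) λ ())) ⟩
  xs ++ []                                                   ≡⟨ List.++-identityʳ xs ⟩
  xs                                                         ∎
  where open ≡-Reasoning

length≤sum : ∀ {xs} → All (0 <_) xs → length xs ≤ sum xs
length≤sum []          = z≤n
length≤sum (0<x ∷ pos) = +-mono-≤ 0<x (length≤sum pos)

-- Projections, cancellation and uniqueness for lists

map-proj₁-zip : {xs : List A} {ys : List B} → length xs ≡ length ys → map proj₁ (zip xs ys) ≡ xs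
map-proj₁-zip {xs = []}     {[]}     _  = refl
map-proj₁-zip {xs = x ∷ xs} {y ∷ ys} eq = cong (x ∷_) (map-proj₁-zip (suc-injective eq))

map-proj₂-zip : {xs : List A} {ys : List B} → length xs ≡ length ys → map proj₂ (zip xs ys) ≡ ys
map-proj₂-zip {xs = []}     {[]}     _  = refl
map-proj₂-zip {xs = x ∷ xs} {y ∷ ys} eq = cong (y ∷_) (map-proj₂-zip (suc-injective eq))

++-cancelˡ-↭ : (zs : List A) {xs ys : List A} → zs ++ xs ↭ zs ++ ys → xs ↭ ys
++-cancelˡ-↭ []       eq = eq
++-cancelˡ-↭ (z ∷ zs) eq = ++-cancelˡ-↭ zs (Perm.drop-∷ eq)

++-cancelʳ-↭ : (zs : List A) {xs ys : List A} → xs ++ zs ↭ ys ++ zs → xs ↭ ys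
++-cancelʳ-↭ zs {xs} {ys} eq = ++-cancelˡ-↭ zs
  (↭-trans (Perm.++-comm zs xs) (↭-trans eq (Perm.++-comm ys zs)))

-- Decreasing lists are the sorted lists of the reversed total order, and a multiset has only one
-- sorted listing.
≥-sorted-↭⇒≡ : ∀ {xs ys} → Linked _≥_ xs → Linked _≥_ ys → xs ↭ ys → xs ≡ ys
≥-sorted-↭⇒≡ xs↘ ys↘ xs↭ys =
  Pointwise-≡⇒≡ (↗↭↗⇒≋ (Flip.totalOrder ≤-totalOrder) xs↘ ys↘ (↭⇒↭ₛ xs↭ys))

Unique⇒lookup-injective : {xs : List A} → Unique xs → ∀ i j → lookup xs i ≡ lookup xs j → i ≡ j
Unique⇒lookup-injective {xs = x ∷ xs} _ zero zero _ = refl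
Unique⇒lookup-injective {xs = x ∷ xs} u zero (suc j) eq =
  contradiction (subst (_∈ₗ xs) (sym eq) (∈-lookup j)) (Unique.Unique[x∷xs]⇒x∉xs u)
Unique⇒lookup-injective {xs = x ∷ xs} u (suc i) zero eq =
  contradiction (subst (_∈ₗ xs) eq (∈-lookup i)) (Unique.Unique[x∷xs]⇒x∉xs u)
Unique⇒lookup-injective {xs = x ∷ xs} (_ ∷ u) (suc i) (suc j) eq = cong suc (Unique⇒lookup-injective u i j eq)

-- The enumeration of partitions

words-length : ∀ alphabet l → All (λ w → length w ≡ l) (words alphabet l)
words-length alphabet zero    = refl ∷ []
words-length alphabet (suc l) = All.cartesianProductWith⁺ (setoid ℕ) (setoid (List ℕ)) _∷_ alphabet (words alphabet l)
  λ _ w∈ → cong suc (All.lookup (words-length alphabet l) w∈)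

words-unique : ∀ {alphabet} → Unique alphabet → ∀ l → Unique (words alphabet l)
words-unique u zero    = [] ∷ []
words-unique u (suc l) = Unique.cartesianProductWith⁺ _∷_ List.∷-injective u (words-unique u l)

-- Words of one length are distinct because the letters of the alphabet are, and words of different
-- lengths never coincide; filtering preserves this.
partitions-unique : ∀ r → Unique (partitions r)
partitions-unique r = Unique.filter⁺ (isPartition? r) (Unique.concat⁺
  (All.map⁺ (All.universal (words-unique (Unique.upTo⁺ (suc r))) (upTo (suc r))))
  (AllPairs.map⁺ (AllPairs.map disjoint (Unique.upTo⁺ (suc r)))))
  where
  disjoint : ∀ {l l′} → l ≢ l′ → Disjoint (words (upTo (suc r)) l) (words (upTo (suc r)) l′)
  disjoint {l} {l′} l≢l′ (w∈ , w∈′) = l≢l′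
    (trans (sym (All.lookup (words-length (upTo (suc r)) l) w∈)) (All.lookup (words-length (upTo (suc r)) l′) w∈′))

partitions-sound : ∀ {r xs} → xs ∈ₗ partitions r → IsPartition r xs
partitions-sound {r} xs∈ = proj₂ (∈-filter⁻ (isPartition? r) {xs = concatMap (words (upTo (suc r))) (upTo (suc r))} xs∈)

-- The graph of a partition and the recovery of the partition

module PartitionGraph (m r : ℕ) (r≤m : r ≤ m) {xs : List ℕ} (xs⊢r : IsPartition r xs) where

  |xs|≤m : length xs ≤ m
  |xs|≤m = ≤-trans (length≤sum (proj₁ (proj₂ xs⊢r))) (≤-trans (≤-reflexive (proj₂ (proj₂ xs⊢r))) r≤m)

  -- Each part of the partition is the number of joining edges at one left vertex. The right ends
  -- depend on `m` and `r` alone, so their excesses are the same for all partitions of `r`.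
  lefts rights : List (Fin m)
  lefts  = blocks (pad xs)
  rights = take r (allFin m)

  |lefts|≡r : length lefts ≡ r
  |lefts|≡r = trans (length-blocks {m} (pad xs)) (trans (∑-pad xs |xs|≤m) (proj₂ (proj₂ xs⊢r)))

  |rights|≡r : length rights ≡ r
  |rights|≡r = trans (List.length-take r (allFin m)) (m≤n⇒m⊓n≡m (≤-trans r≤m (≤-reflexive (sym (List.length-tabulate id)))))

  edges : List (Fin m × Fin m)
  edges = zip lefts rights

  map-proj₁-edges : map proj₁ edges ≡ lefts
  map-proj₁-edges = map-proj₁-zip (trans |lefts|≡r (sym |rights|≡r))

  map-proj₂-edges : map proj₂ edges ≡ rights
  map-proj₂-edges = map-proj₂-zip (trans |lefts|≡r (sym |rights|≡r))

  -- The right ends are pairwise distinct, which keeps the pairs distinct however often a left end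
  -- recurs.
  edges! : Unique edges
  edges! = Unique.map⁻ (subst Unique (sym map-proj₂-edges) (Unique.take⁺ r (Unique.allFin⁺ m)))

  |edges|≡r : length edges ≡ r
  |edges|≡r = trans (sym (List.length-map proj₁ edges)) (trans (cong length map-proj₁-edges) |lefts|≡r)

  open TwoCliques m edges edges! public

  sequence : Vec ℕ (m + m)
  sequence = degreeSequence graph

  filter-excesses : filter (0 <?_) excesses ≡ xs ++ filter (0 <?_) (tabulate (occ rights))
  filter-excesses = begin
    filter (0 <?_) excesses  ≡⟨ List.filter-++ (0 <?_) (tabulate (occ (map proj₁ edges))) _ ⟩
    filter (0 <?_) (tabulate (occ (map proj₁ edges))) ++ filter (0 <?_) (tabulate (occ (map proj₂ edges)))
      ≡⟨ cong₂ (λ ls rs → filter (0 <?_) (tabulate (occ ls)) ++ filter (0 <?_) (tabulate (occ rs))) map-proj₁-edges map-proj₂-edges ⟩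
    filter (0 <?_) (tabulate (occ lefts)) ++ filter (0 <?_) (tabulate (occ rights))
      ≡⟨ cong (λ ls → filter (0 <?_) ls ++ filter (0 <?_) (tabulate (occ rights))) (List.tabulate-cong (occ-blocks {m} (pad xs))) ⟩
    filter (0 <?_) (tabulate {n = m} (pad xs)) ++ filter (0 <?_) (tabulate (occ rights))
      ≡⟨ cong (_++ filter (0 <?_) (tabulate (occ rights))) (filter-pad |xs|≤m (proj₁ (proj₂ xs⊢r))) ⟩
    xs ++ filter (0 <?_) (tabulate (occ rights))  ∎
    where open ≡-Reasoning

-- Equal sequences have the same excesses up to order. Once zeros are dropped, the common
-- contribution of the right side cancels and leaves the two partitions as permutations of each
-- other; both are sorted, so they are equal.
sequence-injective : ∀ m r (r≤m : r ≤ m) {xs ys} (xs⊢r : IsPartition r xs) (ys⊢r : IsPartition r ys) →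
  PartitionGraph.sequence m r r≤m xs⊢r ≡ PartitionGraph.sequence m r r≤m ys⊢r → xs ≡ ys
sequence-injective m r r≤m {xs} {ys} xs⊢r ys⊢r eq =
  ≥-sorted-↭⇒≡ (proj₁ xs⊢r) (proj₁ ys⊢r) (++-cancelʳ-↭ (filter (0 <?_) (tabulate (occ (take r (allFin m)))))
    (subst₂ _↭_ X.filter-excesses Y.filter-excesses (Perm.filter-↭ (0 <?_) excesses↭)))
  where
  module X = PartitionGraph m r r≤m xs⊢r
  module Y = PartitionGraph m r r≤m ys⊢r
  excesses↭ : X.excesses ↭ Y.excesses
  excesses↭ = ↭-trans
    (↭-sym X.degreeSequence⇒excesses)
    (subst (λ π → map (λ d → suc d ∸ m) (toList π) ↭ Y.excesses) (sym eq) Y.degreeSequence⇒excesses)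

-- Counting the sinks

∣sinks∣≥p : ∀ m r → 2 + r ≤ m → ∣ Sink (suc r EdgeConnected) (m + m) ∣≥ p r
∣sinks∣≥p m r 2+r≤m = f , f-injective , λ i → twoCliques-sink 2+r≤m (edges! i) (|edges|≡r i)
  where
  r≤m : r ≤ m
  r≤m = ≤-trans (m≤n+m r 2) 2+r≤m
  sound : ∀ i → IsPartition r (lookup (partitions r) i)
  sound i = partitions-sound (∈-lookup i)
  open module PG i = PartitionGraph m r r≤m (sound i)
  f : Fin (p r) → Vec ℕ (m + m)
  f i = sequence i
  -- Distinct positions in the enumeration hold distinct partitions, and distinct partitions have
  -- distinct degree sequences.
  f-injective : Injective _≡_ _≡_ f
  f-injective {i} {j} fi≡fj = Unique⇒lookup-injective (partitions-unique r) i j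
    (sequence-injective m r r≤m (sound i) (sound j) fi≡fj)

theorem3p1p3 : (k : ℕ) → 2 ≤ k → (n : ℕ) → 4 * k ∸ 2 ≤ n → 2 ∣ n →
    ∣ Sink (k EdgeConnected) n ∣≥ p (k ∸ 1)
theorem3p1p3 (suc (suc k)) (s≤s (s≤s _)) .(q * 2) 4k∸2≤n (divides q refl) =
  subst (λ n → ∣ Sink ((2 + k) EdgeConnected) n ∣≥ p (suc k)) q+q≡q*2 (∣sinks∣≥p q (suc k) 3+k≤q)
  where
  q+q≡q*2 : q + q ≡ q * 2
  q+q≡q*2 = trans (cong (q +_) (sym (+-identityʳ q))) (*-comm 2 q)
  -- Here `k` stands for the original parameter minus 2. The hypothesis says that `q` is at least
  -- twice the original parameter minus 1, and the surplus of that over `3 + k` is `k`; doubled, it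
  -- is the summand `2 * k` below.
  3+k≤q : 3 + k ≤ q
  3+k≤q = *-cancelʳ-≤ (3 + k) q 2 (begin
    (3 + k) * 2            ≤⟨ m≤m+n _ (2 * k) ⟩
    (3 + k) * 2 + 2 * k    ≡⟨ m+n∸m≡n 2 _ ⟨
    2 + ((3 + k) * 2 + 2 * k) ∸ 2
      ≡⟨ cong (_∸ 2) (solve 1 (λ k → con 2 :+ ((con 3 :+ k) :* con 2 :+ con 2 :* k) := con 4 :* (con 2 :+ k)) refl k) ⟩
    4 * (2 + k) ∸ 2        ≤⟨ 4k∸2≤n ⟩
    q * 2                  ∎)
    where
    open ≤-Reasoning
    open +-*-Solver
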